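{- Let $n\ge 2$, $t\ge 2$. Every $\mathbb{F}_q$-linear set $L$ of $\Lambda=PG(V,\mathbb{F}_{q^t})=PG(2n-1,q^t)$ of pseudoregulus type is of the form $L_{\rho,f}$; that is, there exist a decomposition $V=U_1\oplus U_2$ with $\dim U_1=\dim U_2=n$, an invertible semilinear map $f:U_1\to U_2$ whose companion automorphism $\sigma$ satisfies $\mathrm{Fix}(\sigma)=\mathbb{F}_q$, and $\rho\in\mathbb{F}_{q^t}^*$, such that $L=\{\langle\mathbf u+\rho f(\mathbf u)\rangle_{q^t}:\mathbf u\in U_1\setminus\{\mathbf 0\}\}$.
   Context: For an $\mathbb{F}_q$-subspace $U$ of $V$, $L_U=\{\langle\mathbf u\rangle_{q^t}:\mathbf u\in U\setminus\{\mathbf 0\}\}$ is the $\mathbb{F}_q$-linear set defined by $U$, of rank $\dim_{\mathbb F_q}U$; the weight of a subspace $PG(W,\mathbb{F}_{q^t})$ in $L_U$ is $\dim_{\mathbb F_q}(W\cap U)$; $L_U$ is scattered if every point has weight 1. A semilinear map $f$ with companion automorphism $\sigma$ is additive with $f(\lambda\mathbf u)=\lambda^\sigma f(\mathbf u)$. Pseudoregulus type: for $t,n\ge 2$, a scattered $\mathbb{F}_q$-linear set $L=L_U$ of $PG(2n-1,q^t)$ of rank $tn$ is of pseudoregulus type if (i) there exist $(q^{nt}-1)/(q^t-1)$ pairwise disjoint lines $s_i$ each of weight $t$ in $L$, and (ii) there exist exactly two $(n-1)$-dimensional subspaces $T_1,T_2$ disjoint from $L$ with $T_j\cap s_i\ne\emptyset$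 for all $i,j$. -}

module Defs where

open import Level using (Level; _⊔_; suc)
open import Algebra.Bundles using (CommutativeRing)
open import Algebra.Module.Bundles using (Module)
open import Algebra.Morphism.Structures using (IsRingIsomorphism)
import Algebra.Definitions.RawMonoid as RawMonoidSum
open import Data.Fin.Base using (Fin)
open import Data.Nat.Base using (ℕ; _∸_; _^_) renaming (_*_ to _*ℕ_)
open import Data.Product.Base using (Σ; ∃; _×_; _,_; proj₁; proj₂)
open import Data.Sum.Base using (_⊎_)
open import Function.Bundles using (Inverse)
open import Function.Definitions using (Congruent; Bijective)
open import Relation.Binary.Bundles using (Setoid)
import Relation.Binary.Construct.On as On
open import Relation.Binary.PropositionalEquality using (_≡_; _≢_; setoid)
open import Relation.Nullary using (¬_)
open import Relation.Unary using (Pred; _⊆_; _∩_; _≐_)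
open import Relation.Unary.Polymorphic using (U)

private
  variable
    a : Level

HasSize : {c ℓ : Level} → Setoid c ℓ → ℕ → Set (c ⊔ ℓ)
HasSize S k = Inverse (setoid (Fin k)) S

module _ (K : CommutativeRing a a) where
  open CommutativeRing K

  -- Only used for finite K, where ≈ is decidable and so ¬ (x ≈ 0#) serves as
  -- the apartness of a HeytingField.
  record IsField : Set a where
    field
      0≉1     : ¬ (0# ≈ 1#)
      inverse : ∀ x → ¬ (x ≈ 0#) → ∃ λ y → x * y ≈ 1#

  record Subfield : Set (suc a) where
    field
      Mem       : Pred Carrier a
      resp      : ∀ {x y} → x ≈ y → Mem x → Mem y
      0-mem     : Mem 0#
      1-mem     : Mem 1#
      +-closed  : ∀ {x y} → Mem x → Mem y → Mem (x + y)
      *-closed  : ∀ {x y} → Mem x → Mem y → Mem (x * y)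
      neg-closed : ∀ {x} → Mem x → Mem (- x)
      inv-closed : ∀ {x y} → Mem x → x * y ≈ 1# → Mem y

    asSetoid : Setoid a a
    asSetoid = On.setoid {B = Σ Carrier Mem} (CommutativeRing.setoid K) proj₁

module LinearAlgebra (K : CommutativeRing a a) (V : Module K a a) where
  open CommutativeRing K
  open Module V

  ∑ : {k : ℕ} → (Fin k → Carrierᴹ) → Carrierᴹ
  ∑ = RawMonoidSum.sum +ᴹ-rawMonoid

  NonZeroᴹ : Pred Carrierᴹ a
  NonZeroᴹ v = ¬ (v ≈ᴹ 0ᴹ)

  -- Linear notions relative to a set S of scalars, used with S a subfield
  -- of K and with S = U (all of K).
  record IsSubspace (S : Pred Carrier a) (W : Pred Carrierᴹ a) : Set a where
    field
      resp      : ∀ {v w} → v ≈ᴹ w → W v → W w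
      0-mem     : W 0ᴹ
      +-closed  : ∀ {v w} → W v → W w → W (v +ᴹ w)
      *-closed  : ∀ {c v} → S c → W v → W (c *ₗ v)

  record IsBasis (S : Pred Carrier a) (W : Pred Carrierᴹ a)
                 {k : ℕ} (b : Fin k → Carrierᴹ) : Set a where
    field
      mem         : ∀ i → W (b i)
      spanning    : ∀ v → W v → ∃ λ (c : Fin k → Carrier) →
                    (∀ i → S (c i)) × v ≈ᴹ ∑ (λ i → c i *ₗ b i)
      independent : ∀ (c : Fin k → Carrier) → (∀ i → S (c i)) →
                    ∑ (λ i → c i *ₗ b i) ≈ᴹ 0ᴹ → ∀ i → c i ≈ 0#

  -- The S-dimension of W is k (W is always a subspace where this is used).
  HasDim : Pred Carrier a → Pred Carrierᴹ a → ℕ → Set a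
  HasDim S W k = ∃ λ (b : Fin k → Carrierᴹ) → IsBasis S W b

  -- K-subspaces of vector dimension k, i.e. projective dimension k - 1.
  record KSubspace (k : ℕ) : Set (suc a) where
    field
      ∣_∣        : Pred Carrierᴹ a
      isSubspace : IsSubspace U ∣_∣
      hasDim     : HasDim U ∣_∣ k

  open KSubspace public using (∣_∣)

  Point Line : Set (suc a)
  Point = KSubspace 1
  Line  = KSubspace 2

  ⟨_⟩ : Carrierᴹ → Pred Carrierᴹ a
  ⟨ v ⟩ w = ∃ λ c → w ≈ᴹ c *ₗ v

  Disjoint : {j k : ℕ} → KSubspace j → KSubspace k → Set (suc a)
  Disjoint W W′ = ∀ (P : Point) → ¬ (∣ P ∣ ⊆ ∣ W ∣ × ∣ P ∣ ⊆ ∣ W′ ∣)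

  Meets : {j k : ℕ} → KSubspace j → KSubspace k → Set (suc a)
  Meets W W′ = ∃ λ (P : Point) → ∣ P ∣ ⊆ ∣ W ∣ × ∣ P ∣ ⊆ ∣ W′ ∣

  DisjointFrom : {k : ℕ} → Pred Point a → KSubspace k → Set (suc a)
  DisjointFrom L W = ∀ (P : Point) → L P → ¬ (∣ P ∣ ⊆ ∣ W ∣)

  LinearSet : Pred Carrierᴹ a → Pred Point a
  LinearSet W P = ∃ λ u → W u × NonZeroᴹ u × ∣ P ∣ ≐ ⟨ u ⟩

  record IsDirectSum {j k : ℕ} (U₁ : KSubspace j) (U₂ : KSubspace k) : Set a where
    field
      decompose : ∀ v → ∃ λ u₁ → ∃ λ u₂ →
                  ∣ U₁ ∣ u₁ × ∣ U₂ ∣ u₂ × v ≈ᴹ u₁ +ᴹ u₂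
      trivial   : ∀ v → ∣ U₁ ∣ v → ∣ U₂ ∣ v → v ≈ᴹ 0ᴹ

  IsAutomorphism : (Carrier → Carrier) → Set a
  IsAutomorphism = IsRingIsomorphism rawRing rawRing

  record IsInvertibleSemilinear
      {j k : ℕ} (U₁ : KSubspace j) (U₂ : KSubspace k) (σ : Carrier → Carrier)
      (f : Σ Carrierᴹ ∣ U₁ ∣ → Σ Carrierᴹ ∣ U₂ ∣) : Set a where
    open IsSubspace (KSubspace.isSubspace U₁)

    _≈₁_ : (x y : Σ Carrierᴹ ∣ U₁ ∣) → Set a
    x ≈₁ y = proj₁ x ≈ᴹ proj₁ y

    _≈₂_ : (x y : Σ Carrierᴹ ∣ U₂ ∣) → Set a
    x ≈₂ y = proj₁ x ≈ᴹ proj₁ y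

    field
      f-cong     : Congruent _≈₁_ _≈₂_ f
      additive   : ∀ {u v} (p : ∣ U₁ ∣ u) (q : ∣ U₁ ∣ v) →
                   proj₁ (f (u +ᴹ v , +-closed p q))
                     ≈ᴹ proj₁ (f (u , p)) +ᴹ proj₁ (f (v , q))
      semilinear : ∀ c {u} (p : ∣ U₁ ∣ u) →
                   proj₁ (f (c *ₗ u , *-closed {c} _ p))
                     ≈ᴹ σ c *ₗ proj₁ (f (u , p))
      bijective  : Bijective _≈₁_ _≈₂_ f

  module _ (F : Subfield K) where
    private
      F∋ : Pred Carrier a
      F∋ = Subfield.Mem F

    record IsPseudoregulusType (q n t : ℕ) (L : Pred Point a)
        : Set (suc a) where
      field
        W          : Pred Carrierᴹ a
        W-subspace : IsSubspace F∋ W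
        L≐L_W      : L ≐ LinearSet W
        rank       : HasDim F∋ W (t *ℕ n)
        scattered  : ∀ (P : Point) → L P → HasDim F∋ (∣ P ∣ ∩ W) 1

        -- N = (q^{nt} - 1) / (q^t - 1); the division is exact.
        N               : ℕ
        N-spec          : N *ℕ (q ^ t ∸ 1) ≡ q ^ (n *ℕ t) ∸ 1
        lines           : Fin N → Line
        lines-disjoint  : ∀ i j → i ≢ j → Disjoint (lines i) (lines j)
        lines-weight    : ∀ i → HasDim F∋ (∣ lines i ∣ ∩ W) t

      IsTransversal : KSubspace n → Set (suc a)
      IsTransversal T = DisjointFrom L T × (∀ i → Meets T (lines i))

      field
        T₁ T₂          : KSubspace n
        T₁-transversal : IsTransversal T₁
        T₂-transversal : IsTransversal T₂
        T₁≢T₂          : ¬ (∣ T₁ ∣ ≐ ∣ T₂ ∣)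
        only-two       : ∀ (T : KSubspace n) → IsTransversal T →
                         (∣ T ∣ ≐ ∣ T₁ ∣) ⊎ (∣ T ∣ ≐ ∣ T₂ ∣)

    -- L_{ρ,f} = { ⟨u + ρ f(u)⟩ : u ∈ U₁ ∖ {0} }
    L[_,_] : {n : ℕ} {U₁ U₂ : KSubspace n} → Carrier →
             (Σ Carrierᴹ ∣ U₁ ∣ → Σ Carrierᴹ ∣ U₂ ∣) → Pred Point a
    L[_,_] {U₁ = U₁} ρ f P =
      ∃ λ (u : Σ Carrierᴹ ∣ U₁ ∣) → NonZeroᴹ (proj₁ u) ×
        ∣ P ∣ ≐ ⟨ proj₁ u +ᴹ ρ *ₗ proj₁ (f u) ⟩

    record IsOfForm-Lρf (n : ℕ) (L : Pred Point a) : Set (suc a) where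
      field
        U₁ U₂      : KSubspace n
        directSum  : IsDirectSum U₁ U₂
        σ          : Carrier → Carrier
        σ-auto     : IsAutomorphism σ
        Fix-σ      : (λ x → σ x ≈ x) ≐ F∋
        f          : Σ Carrierᴹ ∣ U₁ ∣ → Σ Carrierᴹ ∣ U₂ ∣
        f-semilin  : IsInvertibleSemilinear U₁ U₂ σ f
        ρ          : Carrier
        ρ≉0        : ¬ (ρ ≈ 0#)
        L≐L[ρ,f]   : L ≐ L[_,_] {U₁ = U₁} {U₂ = U₂} ρ f

{-# OPTIONS --safe #-}
module Submission where

-- The lines s_i meet W in N blocks of q^t vectors, pairwise sharing only 0, so by counting
-- they partition the nonzero vectors of W; likewise the points T ∩ s_i partition each
-- transversal T. Counting also gives V = W ⊕ T over F_q, hence W ≅ V/T₁ and W ≅ V/T₂, and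
-- W carries two K-structures with the same one-dimensional subspaces, the blocks W ∩ s_i.
-- As in the fundamental theorem of projective geometry, the two structures differ by an
-- automorphism σ of K. A common nonzero vector of T₁ and T₂ would force σ = id, and then
-- T₁ = T₂, because c w ∉ W for w ∈ W ∖ {0} and c ∉ F_q. So V = T₁ ⊕ T₂, and W is the graph
-- of a map f : T₁ → T₂, which is σ-semilinear.

open import Defs
open import Level using (Level; _⊔_)
open import Algebra.Bundles using (CommutativeMonoid; CommutativeRing)
open import Algebra.Module.Bundles using (Module)
import Algebra.Properties.AbelianGroup as AbelianGroupProperties
import Algebra.Properties.CommutativeMonoid.Sum as CommutativeMonoidSum
import Algebra.Properties.CommutativeSemigroup as CommutativeSemigroupProperties
import Algebra.Properties.Group as GroupProperties
open import Data.Empty using (⊥-elim)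
open import Data.Fin.Base using (Fin; zero; suc; combine; remQuot; punchIn; punchOut; funToFin; finToFun; fromℕ<)
import Data.Fin.Properties as Fin
open import Data.Nat.Base as ℕ using (ℕ; zero; suc; _≤_; _<_; _∸_; _^_; s≤s; z≤n)
import Data.Nat.Properties as ℕ
open import Data.Product.Base using (Σ; ∃; _×_; _,_; proj₁; proj₂)
open import Function.Base using (_∘_; case_of_)
open import Function.Bundles using (Inverse)
open import Relation.Binary.Bundles using (Setoid)
import Relation.Binary.Construct.On as On
import Relation.Binary.Reasoning.Setoid as SetoidReasoning
open import Relation.Binary.PropositionalEquality as ≡ using (_≡_; _≢_)
open import Relation.Nullary using (¬_; Dec; yes; no; contradiction)
open import Relation.Nullary.Decidable using (map′; ¬?; decidable-stable)
open import Relation.Unary using (Pred; _⊆_; _∩_; _≐_)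
open import Relation.Unary.Polymorphic using (U)

-- Counting finite sets inside a setoid

private
  variable
    a b p : Level
    k m n : ℕ

-- A missed value `y` could be punched out of the codomain, leaving an injection from `Fin (suc n)`
-- to `Fin n`.
Fin-injective⇒surjective : (g : Fin n → Fin n) → (∀ {i j} → g i ≡ g j → i ≡ j) →
                           ∀ y → ∃ λ x → g x ≡ y
Fin-injective⇒surjective {suc n} g g-inj y with Fin.any? (λ x → g x Fin.≟ y)
... | yes hit = hit
... | no miss = contradiction (Fin.injective⇒≤ {f = h} h-inj) (ℕ.<⇒≱ (ℕ.n<1+n n))
  where
  y≢g : ∀ x → y ≢ g x
  y≢g x y≡gx = miss (x , ≡.sym y≡gx)

  h : Fin (suc n) → Fin n
  h x = punchOut (y≢g x)

  h-inj : ∀ {i j} → h i ≡ h j → i ≡ j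
  h-inj {i} {j} = g-inj ∘ Fin.punchOut-injective (y≢g i) (y≢g j)

module Counting (S : Setoid a b) where
  open Setoid S using (Carrier; _≈_) renaming (sym to ≈-sym; trans to ≈-trans)

  -- Finiteness of a predicate up to `≈`; `elem-inj` compares elements only, so different proofs of
  -- membership never count twice.
  record Enumeration (X : Pred Carrier p) (k : ℕ) : Set (a ⊔ b ⊔ p) where
    field
      elem     : Fin k → Carrier
      elem-∈   : ∀ i → X (elem i)
      elem-inj : ∀ {i j} → elem i ≈ elem j → i ≡ j
      covers   : ∀ {x} → X x → ∃ λ i → x ≈ elem i

    index : ∀ {x} → X x → Fin k
    index x∈X = proj₁ (covers x∈X)

    index-inj : ∀ {x y} (x∈X : X x) (y∈X : X y) → index x∈X ≡ index y∈X → x ≈ y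
    index-inj x∈X y∈X eq with covers x∈X | covers y∈X
    ... | i , x≈i | j , y≈j with ≡.refl ← eq = ≈-trans x≈i (≈-sym y≈j)

    index-cong : ∀ {x y} (x∈X : X x) (y∈X : X y) → x ≈ y → index x∈X ≡ index y∈X
    index-cong x∈X y∈X x≈y =
      elem-inj (≈-trans (≈-sym (proj₂ (covers x∈X))) (≈-trans x≈y (proj₂ (covers y∈X))))

    ≈-dec : ∀ {x y} → X x → X y → Dec (x ≈ y)
    ≈-dec x∈X y∈X with index x∈X Fin.≟ index y∈X
    ... | yes eq = yes (index-inj x∈X y∈X eq)
    ... | no neq = no (neq ∘ index-cong x∈X y∈X)

  open Enumeration

  injective⇒exhausts : {X : Pred Carrier p} → Enumeration X k → (g : Fin k → Carrier) →
                       (∀ i → X (g i)) → (∀ {i j} → g i ≈ g j → i ≡ j) →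
                       ∀ {x} → X x → ∃ λ i → x ≈ g i
  injective⇒exhausts E g g∈X g-inj x∈X
    with i , eq ← Fin-injective⇒surjective (λ i → index E (g∈X i))
                    (g-inj ∘ index-inj E (g∈X _) (g∈X _)) (index E x∈X)
    = i , ≈-sym (index-inj E (g∈X i) x∈X eq)

  -- Outside `o` the `N` blocks are disjoint with `m` elements each. Together with `o` this makes
  -- `suc (N * m)` distinct elements, which is all of `Y`.
  blocks-cover : {N m : ℕ} {Y : Pred Carrier p} {o : Carrier} (X : Fin N → Pred Carrier p) →
                 Enumeration Y (suc (N ℕ.* m)) → (∀ i → Enumeration (X i) (suc m)) →
                 (∀ i → X i ⊆ Y) → (∀ i {x y} → x ≈ y → X i x → X i y) → Y o → (∀ i → X i o) →
                 (∀ {i j x} → i ≢ j → X i x → X j x → x ≈ o) →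
                 ∀ {y} → Y y → ¬ (y ≈ o) → ∃ λ i → X i y
  blocks-cover {N = N} {m} {Y} {o} X EY EX X⊆Y X-resp o∈Y o∈X X∩X y∈Y y≉o =
    case injective⇒exhausts EY g g∈Y g-inj y∈Y of λ where
      (zero  , y≈o) → contradiction y≈o y≉o
      (suc r , y≈e) → _ , X-resp _ (≈-sym y≈e) (blockElem∈ _ _)
    where
    -- `punchIn` skips the position of `o`, so `l` runs through the `m` other elements of block `i`.
    blockElem : ∀ i → Fin m → Carrier
    blockElem i l = elem (EX i) (punchIn (index (EX i) (o∈X i)) l)

    blockElem∈ : ∀ i l → X i (blockElem i l)
    blockElem∈ i l = elem-∈ (EX i) _

    blockElem≉o : ∀ i l → ¬ (blockElem i l ≈ o)
    blockElem≉o i l e≈o = Fin.punchInᵢ≢i (index (EX i) (o∈X i)) l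
      (elem-inj (EX i) (≈-trans e≈o (proj₂ (covers (EX i) (o∈X i)))))

    blockElem-inj : ∀ {i j l l′} → blockElem i l ≈ blockElem j l′ → i ≡ j × l ≡ l′
    blockElem-inj {i} {j} {l} {l′} e≈e′ with i Fin.≟ j
    ... | yes ≡.refl = ≡.refl , Fin.punchIn-injective _ l l′ (elem-inj (EX i) e≈e′)
    ... | no i≢j = contradiction
      (X∩X i≢j (blockElem∈ i l) (X-resp j (≈-sym e≈e′) (blockElem∈ j l′))) (blockElem≉o i l)

    g : Fin (suc (N ℕ.* m)) → Carrier
    g zero    = o
    g (suc r) = blockElem (proj₁ (remQuot {N} m r)) (proj₂ (remQuot {N} m r))

    g∈Y : ∀ r → Y (g r)
    g∈Y zero    = o∈Y
    g∈Y (suc r) = X⊆Y _ (blockElem∈ _ _)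

    g-inj : ∀ {r s} → g r ≈ g s → r ≡ s
    g-inj {zero}  {zero}  _  = ≡.refl
    g-inj {zero}  {suc s} eq = contradiction (≈-sym eq) (blockElem≉o _ _)
    g-inj {suc r} {zero}  eq = contradiction eq (blockElem≉o _ _)
    g-inj {suc r} {suc s} eq with i≡ , l≡ ← blockElem-inj eq = ≡.cong suc
      (≡.trans (≡.sym (Fin.combine-remQuot {N} m r))
        (≡.trans (≡.cong₂ combine i≡ l≡) (Fin.combine-remQuot {N} m s)))

  full-enumeration : HasSize S k → Enumeration (U {ℓ = p}) k
  full-enumeration size = record
    { elem     = to
    ; elem-∈   = λ _ → _
    ; elem-inj = λ {i} {j} eq → ≡.trans (≡.sym (strictlyInverseʳ i)) (≡.trans (from-cong eq) (strictlyInverseʳ j))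
    ; covers   = λ {x} _ → from x , ≈-sym (strictlyInverseˡ x)
    }
    where open Inverse size

  subset-enumeration : {X : Pred Carrier p} → HasSize (On.setoid {B = Σ Carrier X} S proj₁) k →
                       Enumeration X k
  subset-enumeration size = record
    { elem     = proj₁ ∘ to
    ; elem-∈   = proj₂ ∘ to
    ; elem-inj = λ {i} {j} eq → ≡.trans (≡.sym (strictlyInverseʳ i)) (≡.trans (from-cong eq) (strictlyInverseʳ j))
    ; covers   = λ {x} x∈X → from (x , x∈X) , ≈-sym (strictlyInverseˡ (x , x∈X))
    }
    where open Inverse size

  distinct⇒2≤ : {X : Pred Carrier p} → Enumeration X k → ∀ {x y} → X x → X y → ¬ (x ≈ y) → 2 ≤ k
  distinct⇒2≤ {k = k} E x∈X y∈X x≉y with k | index E x∈X | index E y∈X | index-inj E x∈X y∈X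
  ... | suc zero    | zero | zero | inj = contradiction (inj ≡.refl) x≉y
  ... | suc (suc _) | _    | _    | _   = s≤s (s≤s z≤n)

  2≤⇒other : {X : Pred Carrier p} → Enumeration X k → 2 ≤ k → ∀ {x} → X x → ∃ λ y → X y × ¬ (y ≈ x)
  2≤⇒other E (s≤s (s≤s _)) {x} x∈X with index E x∈X in eq
  ... | zero  = elem E (suc zero) , elem-∈ E _ , λ e≈x →
    case ≡.trans (elem-inj E (≈-trans e≈x (proj₂ (covers E x∈X)))) eq of λ ()
  ... | suc i = elem E zero , elem-∈ E _ , λ e≈x →
    case ≡.trans (elem-inj E (≈-trans e≈x (proj₂ (covers E x∈X)))) eq of λ ()

-- Linear algebra over a field: congruence modulo a subspace, sizes, complements

module Linear {a} (K : CommutativeRing a a) (K-field : IsField K) (V : Module K a a) where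
  open CommutativeRing K hiding (zero)
  open Module V
  open LinearAlgebra K V
  open IsField K-field
  private
    module KG = GroupProperties +-group
    module MG = GroupProperties +ᴹ-group
    module MA = AbelianGroupProperties +ᴹ-abelianGroup
    module MS = CommutativeMonoidSum +ᴹ-commutativeMonoid
    module MC = CommutativeSemigroupProperties (CommutativeMonoid.commutativeSemigroup +ᴹ-commutativeMonoid)
  open Counting ≈ᴹ-setoid
  module KC = Counting setoid

  infixl 6 _-ᴹ_
  _-ᴹ_ : Carrierᴹ → Carrierᴹ → Carrierᴹ
  v -ᴹ w = v +ᴹ -ᴹ w

  *ₗ-negʳ : ∀ c v → c *ₗ (-ᴹ v) ≈ᴹ -ᴹ (c *ₗ v)
  *ₗ-negʳ c v = MG.inverseˡ-unique _ _ (begin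
    c *ₗ (-ᴹ v) +ᴹ c *ₗ v    ≈⟨ *ₗ-distribˡ c _ _ ⟨
    c *ₗ (-ᴹ v +ᴹ v)         ≈⟨ *ₗ-congˡ (-ᴹ‿inverseˡ v) ⟩
    c *ₗ 0ᴹ                  ≈⟨ *ₗ-zeroʳ c ⟩
    0ᴹ                       ∎)
    where open SetoidReasoning ≈ᴹ-setoid

  *ₗ-negˡ : ∀ c v → (- c) *ₗ v ≈ᴹ -ᴹ (c *ₗ v)
  *ₗ-negˡ c v = MG.inverseˡ-unique _ _ (begin
    (- c) *ₗ v +ᴹ c *ₗ v     ≈⟨ *ₗ-distribʳ v _ _ ⟨
    (- c + c) *ₗ v           ≈⟨ *ₗ-congʳ (-‿inverseˡ c) ⟩
    0# *ₗ v                  ≈⟨ *ₗ-zeroˡ v ⟩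
    0ᴹ                       ∎)
    where open SetoidReasoning ≈ᴹ-setoid

  -1*v≈-v : ∀ v → (- 1#) *ₗ v ≈ᴹ -ᴹ v
  -1*v≈-v v = ≈ᴹ-trans (*ₗ-negˡ 1# v) (-ᴹ‿cong (*ₗ-identityˡ v))

  *ₗ-cancel : ∀ {c v} → ¬ (c ≈ 0#) → c *ₗ v ≈ᴹ 0ᴹ → v ≈ᴹ 0ᴹ
  *ₗ-cancel {c} {v} c≉0 cv≈0 with d , cd≈1 ← inverse c c≉0 = begin
    v                ≈⟨ *ₗ-identityˡ v ⟨
    1# *ₗ v          ≈⟨ *ₗ-congʳ (trans (sym cd≈1) (*-comm c d)) ⟩
    (d * c) *ₗ v     ≈⟨ *ₗ-assoc d c v ⟩
    d *ₗ (c *ₗ v)    ≈⟨ *ₗ-congˡ cv≈0 ⟩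
    d *ₗ 0ᴹ          ≈⟨ *ₗ-zeroʳ d ⟩
    0ᴹ               ∎
    where open SetoidReasoning ≈ᴹ-setoid

  *ₗ-distribʳ-minus : ∀ c d v → (c - d) *ₗ v ≈ᴹ c *ₗ v -ᴹ d *ₗ v
  *ₗ-distribʳ-minus c d v = ≈ᴹ-trans (*ₗ-distribʳ v c (- d)) (+ᴹ-congˡ (*ₗ-negˡ d v))

  +ᴹ-minus : ∀ v w → v +ᴹ (w -ᴹ v) ≈ᴹ w
  +ᴹ-minus v w = ≈ᴹ-trans (+ᴹ-comm v _) (MG.//-rightDividesˡ v w)

  +ᴹ-interchange : ∀ u v x y → (u +ᴹ v) +ᴹ (x +ᴹ y) ≈ᴹ (u +ᴹ x) +ᴹ (v +ᴹ y)
  +ᴹ-interchange = MC.interchange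

  -- Closure under negation comes from scaling by -1, which lies in both scalar sets in use, the
  -- subfield and all of `K`.
  module Subspace {S : Pred Carrier a} {X : Pred Carrierᴹ a} (X-sub : IsSubspace S X)
                  (S∋-1 : S (- 1#)) where
    open IsSubspace X-sub public

    neg-closed : ∀ {v} → X v → X (-ᴹ v)
    neg-closed v∈X = resp (-1*v≈-v _) (*-closed S∋-1 v∈X)

    minus-closed : ∀ {v w} → X v → X w → X (v -ᴹ w)
    minus-closed v∈X w∈X = +-closed v∈X (neg-closed w∈X)

  infix 4 _~_[mod_]
  -- The quotient of V by `X`, as a congruence on V rather than a new module.
  _~_[mod_] : Carrierᴹ → Carrierᴹ → Pred Carrierᴹ a → Set a
  v ~ w [mod X ] = X (v -ᴹ w)

  module Mod {X : Pred Carrierᴹ a} (X-sub : IsSubspace U X) where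
    open Subspace X-sub _

    ≈⇒~ : ∀ {v w} → v ≈ᴹ w → v ~ w [mod X ]
    ≈⇒~ v≈w = resp (≈ᴹ-sym (MG.x≈y⇒x∙y⁻¹≈ε v≈w)) 0-mem

    ~-sym : ∀ {v w} → v ~ w [mod X ] → w ~ v [mod X ]
    ~-sym {v} {w} = resp (MA.⁻¹-anti-homo‿- v w) ∘ neg-closed

    ~-trans : ∀ {u v w} → u ~ v [mod X ] → v ~ w [mod X ] → u ~ w [mod X ]
    ~-trans {u} {v} {w} u~v v~w = resp eq (+-closed u~v v~w)
      where
      open SetoidReasoning ≈ᴹ-setoid
      eq : (u -ᴹ v) +ᴹ (v -ᴹ w) ≈ᴹ u -ᴹ w
      eq = begin
        (u -ᴹ v) +ᴹ (v -ᴹ w)     ≈⟨ +ᴹ-assoc (u -ᴹ v) v (-ᴹ w) ⟨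
        ((u -ᴹ v) +ᴹ v) -ᴹ w     ≈⟨ +ᴹ-congʳ (MG.//-rightDividesˡ v u) ⟩
        u -ᴹ w                   ∎

    mod-setoid : Setoid a a
    mod-setoid = record
      { Carrier = Carrierᴹ
      ; _≈_ = λ v w → v ~ w [mod X ]
      ; isEquivalence = record { refl = ≈⇒~ ≈ᴹ-refl ; sym = ~-sym ; trans = ~-trans }
      }

    +-cong-~ : ∀ {u v x y} → u ~ v [mod X ] → x ~ y [mod X ] → u +ᴹ x ~ v +ᴹ y [mod X ]
    +-cong-~ {u} {v} {x} {y} u~v x~y = resp eq (+-closed u~v x~y)
      where
      open SetoidReasoning ≈ᴹ-setoid
      eq : (u -ᴹ v) +ᴹ (x -ᴹ y) ≈ᴹ (u +ᴹ x) -ᴹ (v +ᴹ y)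
      eq = begin
        (u -ᴹ v) +ᴹ (x -ᴹ y)          ≈⟨ MC.interchange u (-ᴹ v) x (-ᴹ y) ⟩
        (u +ᴹ x) +ᴹ (-ᴹ v +ᴹ -ᴹ y)    ≈⟨ +ᴹ-congˡ (MA.⁻¹-∙-comm v y) ⟩
        (u +ᴹ x) -ᴹ (v +ᴹ y)          ∎

    *-cong-~ : ∀ c {v w} → v ~ w [mod X ] → c *ₗ v ~ c *ₗ w [mod X ]
    *-cong-~ c {v} {w} v~w = resp
      (≈ᴹ-trans (*ₗ-distribˡ c _ _) (+ᴹ-congˡ (*ₗ-negʳ c w))) (*-closed _ v~w)

    ∈⇒~0 : ∀ {v} → X v → v ~ 0ᴹ [mod X ]
    ∈⇒~0 {v} = resp (≈ᴹ-sym (≈ᴹ-trans (+ᴹ-congˡ MG.ε⁻¹≈ε) (+ᴹ-identityʳ v)))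

    ~0⇒∈ : ∀ {v} → v ~ 0ᴹ [mod X ] → X v
    ~0⇒∈ {v} = resp (≈ᴹ-trans (+ᴹ-congˡ MG.ε⁻¹≈ε) (+ᴹ-identityʳ v))

    +-cancel-~ : ∀ {u v x y} → u +ᴹ x ~ v +ᴹ y [mod X ] → u -ᴹ v ~ y -ᴹ x [mod X ]
    +-cancel-~ {u} {v} {x} {y} ux~vy = resp eq ux~vy
      where
      open SetoidReasoning ≈ᴹ-setoid
      eq : (u +ᴹ x) -ᴹ (v +ᴹ y) ≈ᴹ (u -ᴹ v) -ᴹ (y -ᴹ x)
      eq = begin
        (u +ᴹ x) -ᴹ (v +ᴹ y)          ≈⟨ +ᴹ-congˡ (MA.⁻¹-∙-comm v y) ⟨
        (u +ᴹ x) +ᴹ (-ᴹ v +ᴹ -ᴹ y)    ≈⟨ MC.interchange u x (-ᴹ v) (-ᴹ y) ⟩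
        (u -ᴹ v) +ᴹ (x -ᴹ y)          ≈⟨ +ᴹ-congˡ (MA.⁻¹-anti-homo‿- y x) ⟨
        (u -ᴹ v) -ᴹ (y -ᴹ x)          ∎

  ∑-closed : ∀ {S X} → IsSubspace S X → {c : Fin k → Carrier} {b : Fin k → Carrierᴹ} →
             (∀ i → S (c i)) → (∀ i → X (b i)) → X (∑ (λ i → c i *ₗ b i))
  ∑-closed {k = zero}  X-sub c∈S b∈X = IsSubspace.0-mem X-sub
  ∑-closed {k = suc k} X-sub c∈S b∈X = IsSubspace.+-closed X-sub
    (IsSubspace.*-closed X-sub (c∈S zero) (b∈X zero))
    (∑-closed X-sub (c∈S ∘ suc) (b∈X ∘ suc))

  coordinates-unique : ∀ {S X} → (∀ {x y} → S x → S y → S (x - y)) →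
    {b : Fin k → Carrierᴹ} → IsBasis S X b → (c d : Fin k → Carrier) →
    (∀ i → S (c i)) → (∀ i → S (d i)) →
    ∑ (λ i → c i *ₗ b i) ≈ᴹ ∑ (λ i → d i *ₗ b i) → ∀ i → c i ≈ d i
  coordinates-unique S-minus {b} b-basis c d c∈S d∈S eq i =
    KG.x∙y⁻¹≈ε⇒x≈y _ _ (IsBasis.independent b-basis (λ j → c j - d j)
      (λ j → S-minus (c∈S j) (d∈S j)) diff≈0 i)
    where
    open SetoidReasoning ≈ᴹ-setoid
    cb db : _
    cb j = c j *ₗ b j
    db j = d j *ₗ b j
    diff≈0 : ∑ (λ j → (c j - d j) *ₗ b j) ≈ᴹ 0ᴹ
    diff≈0 = MG.∙-cancelʳ (∑ db) _ _ (begin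
      ∑ (λ j → (c j - d j) *ₗ b j) +ᴹ ∑ db        ≈⟨ MS.∑-distrib-+ _ db ⟨
      ∑ (λ j → (c j - d j) *ₗ b j +ᴹ d j *ₗ b j)
        ≈⟨ MS.sum-cong-≋ (λ j → ≈ᴹ-trans (≈ᴹ-sym (*ₗ-distribʳ (b j) _ _))
             (*ₗ-congʳ (KG.//-rightDividesˡ (d j) (c j)))) ⟩
      ∑ cb                                        ≈⟨ eq ⟩
      ∑ db                                        ≈⟨ +ᴹ-identityˡ _ ⟨
      0ᴹ +ᴹ ∑ db                                  ∎)

  -- A vector is its tuple of coordinates in `S`, and `finToFun` and `funToFin` code such tuples by
  -- `Fin (s ^ k)`.
  subspace-enumeration : ∀ {S X s} → (∀ {x y} → S x → S y → S (x - y)) →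
    KC.Enumeration S s → IsSubspace S X → HasDim S X k → Enumeration X (s ^ k)
  subspace-enumeration {k = k} {S} {X} {s} S-minus ES X-sub (b , b-basis) = record
    { elem     = λ r → ∑ (λ i → coord r i *ₗ b i)
    ; elem-∈   = λ r → ∑-closed X-sub (coord∈ r) (IsBasis.mem b-basis)
    ; elem-inj = λ {r} {r′} eq → ≡.trans (≡.sym (Fin.funToFin-finToFin {k} r))
        (≡.trans (funToFin-cong (λ i → KC.Enumeration.elem-inj ES
            (coordinates-unique S-minus b-basis (coord r) (coord r′) (coord∈ r) (coord∈ r′) eq i)))
          (Fin.funToFin-finToFin {k} r′))
    ; covers   = λ {v} v∈X → let c , c∈S , v≈ = IsBasis.spanning b-basis v v∈X in
        funToFin (λ i → KC.Enumeration.index ES (c∈S i)) ,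
        ≈ᴹ-trans v≈ (MS.sum-cong-≋ λ i → *ₗ-congʳ (trans (proj₂ (KC.Enumeration.covers ES (c∈S i)))
          (reflexive (≡.cong (KC.Enumeration.elem ES)
            (≡.sym (Fin.finToFun-funToFin (λ j → KC.Enumeration.index ES (c∈S j)) i))))))
    }
    where
    coord : Fin (s ^ k) → Fin k → Carrier
    coord r i = KC.Enumeration.elem ES (finToFun {s} {k} r i)
    coord∈ : ∀ r i → S (coord r i)
    coord∈ r i = KC.Enumeration.elem-∈ ES _
    funToFin-cong : ∀ {k} {g h : Fin k → Fin s} → (∀ i → g i ≡ h i) → funToFin g ≡ funToFin h
    funToFin-cong {zero}  g≗h = ≡.refl
    funToFin-cong {suc k} g≗h = ≡.cong₂ combine (g≗h zero) (funToFin-cong (g≗h ∘ suc))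

  abstract
    -- The sums of `x` in `X` and `τ` in `T` are distinct: congruence modulo `T` fixes `x`, and then
    -- `τ`. Their number `m * n` is that of `Y`, so they exhaust it. `X` is just a set of
    -- representatives, which lets it be an F-subspace such as `W`.
    complement-by-counting : {X T Y : Pred Carrierᴹ a} → IsSubspace U T → IsSubspace U Y →
      Enumeration X m → Enumeration T n → Enumeration Y (m ℕ.* n) → X ⊆ Y → T ⊆ Y →
      (∀ {x x′} → X x → X x′ → x ~ x′ [mod T ] → x ≈ᴹ x′) →
      ∀ {y} → Y y → ∃ λ x → X x × y ~ x [mod T ]
    complement-by-counting {m = m} {n} {X} {T} {Y} T-sub Y-sub EX ET EY X⊆Y T⊆Y X∩T y∈Y =
      let r , y≈ = injective⇒exhausts EY g g∈Y g-inj y∈Y in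
      x r , elem-∈ EX _ , ~-trans (≈⇒~ y≈) (g~x r)
      where
      open Enumeration
      open Mod T-sub
      open Subspace T-sub _
      x τ g : Fin (m ℕ.* n) → Carrierᴹ
      x r = elem EX (proj₁ (remQuot {m} n r))
      τ r = elem ET (proj₂ (remQuot {m} n r))
      g r = x r +ᴹ τ r
      g∈Y : ∀ r → Y (g r)
      g∈Y r = IsSubspace.+-closed Y-sub (X⊆Y (elem-∈ EX _)) (T⊆Y (elem-∈ ET _))
      g~x : ∀ r → g r ~ x r [mod T ]
      g~x r = resp (≈ᴹ-sym (MA.xyx⁻¹≈y (x r) (τ r))) (elem-∈ ET _)
      g-inj : ∀ {r s} → g r ≈ᴹ g s → r ≡ s
      g-inj {r} {s} gr≈gs = ≡.trans (≡.sym (Fin.combine-remQuot {m} n r))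
        (≡.trans (≡.cong₂ combine (elem-inj EX x≈) (elem-inj ET τ≈)) (Fin.combine-remQuot {m} n s))
        where
        x≈ : x r ≈ᴹ x s
        x≈ = X∩T (elem-∈ EX _) (elem-∈ EX _) (~-trans (~-sym (g~x r)) (~-trans (≈⇒~ gr≈gs) (g~x s)))
        τ≈ : τ r ≈ᴹ τ s
        τ≈ = MG.∙-cancelˡ (x r) _ _ (≈ᴹ-trans gr≈gs (+ᴹ-congʳ (≈ᴹ-sym x≈)))

  ⟨⟩-subspace : ∀ v → IsSubspace U ⟨ v ⟩
  ⟨⟩-subspace v = record
    { resp     = λ x≈y (c , x≈) → c , ≈ᴹ-trans (≈ᴹ-sym x≈y) x≈
    ; 0-mem    = 0# , ≈ᴹ-sym (*ₗ-zeroˡ v)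
    ; +-closed = λ (c , x≈) (d , y≈) → c + d , ≈ᴹ-trans (+ᴹ-cong x≈ y≈) (≈ᴹ-sym (*ₗ-distribʳ v c d))
    ; *-closed = λ {e} _ (c , x≈) → e * c , ≈ᴹ-trans (*ₗ-congˡ x≈) (≈ᴹ-sym (*ₗ-assoc e c v))
    }

  ∈⟨⟩ : ∀ v → ⟨ v ⟩ v
  ∈⟨⟩ v = 1# , ≈ᴹ-sym (*ₗ-identityˡ v)

  ⟨⟩-cong : ∀ {v w} → v ≈ᴹ w → ⟨ v ⟩ ≐ ⟨ w ⟩
  ⟨⟩-cong v≈w = (λ (c , x≈) → c , ≈ᴹ-trans x≈ (*ₗ-congˡ v≈w)) ,
                (λ (c , x≈) → c , ≈ᴹ-trans x≈ (*ₗ-congˡ (≈ᴹ-sym v≈w)))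

  ⟨⟩-⊆ : ∀ {X v} → IsSubspace U X → X v → ⟨ v ⟩ ⊆ X
  ⟨⟩-⊆ X-sub v∈X (c , x≈) =
    IsSubspace.resp X-sub (≈ᴹ-sym x≈) (IsSubspace.*-closed X-sub {c} _ v∈X)

  module _ (_≟_ : ∀ x y → Dec (x ≈ y)) where

    nonzero-cancel : ∀ {c v} → NonZeroᴹ v → c *ₗ v ≈ᴹ 0ᴹ → c ≈ 0#
    nonzero-cancel {c} v≉0 cv≈0 with c ≟ 0#
    ... | yes c≈0 = c≈0
    ... | no  c≉0 = contradiction (*ₗ-cancel c≉0 cv≈0) v≉0

    *ₗ-injectiveʳ : ∀ {c d v} → NonZeroᴹ v → c *ₗ v ≈ᴹ d *ₗ v → c ≈ d
    *ₗ-injectiveʳ {c} {d} {v} v≉0 cv≈dv = KG.x∙y⁻¹≈ε⇒x≈y c d (nonzero-cancel v≉0 (begin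
      (c - d) *ₗ v             ≈⟨ *ₗ-distribʳ-minus c d v ⟩
      c *ₗ v -ᴹ d *ₗ v         ≈⟨ MG.x≈y⇒x∙y⁻¹≈ε cv≈dv ⟩
      0ᴹ                       ∎))
      where open SetoidReasoning ≈ᴹ-setoid

    point : ∀ v → NonZeroᴹ v → Point
    point v v≉0 = record
      { ∣_∣        = ⟨ v ⟩
      ; isSubspace = ⟨⟩-subspace v
      ; hasDim     = (λ _ → v) , record
          { mem         = λ _ → ∈⟨⟩ v
          ; spanning    = λ w (c , w≈) → (λ _ → c) , _ , ≈ᴹ-trans w≈ (≈ᴹ-sym (+ᴹ-identityʳ _))
          ; independent = λ c _ cv≈0 → λ where
              zero → nonzero-cancel v≉0 (≈ᴹ-trans (≈ᴹ-sym (+ᴹ-identityʳ _)) cv≈0)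
          }
      }

-- `N = 0` would give `Q ^ n ≤ 1`, and `N = 1` would give `Q ^ n ≤ Q`. A second line is what allows
-- scalars to be compared along different lines.
2≤quotient : ∀ {N Q n} → 2 ≤ Q → 2 ≤ n → N ℕ.* (Q ∸ 1) ≡ Q ^ n ∸ 1 → 2 ≤ N
2≤quotient {zero} {Q} {n} 2≤Q 2≤n eq = contradiction
  (ℕ.m∸n≡0⇒m≤n (≡.sym eq)) (ℕ.<⇒≱ (ℕ.^-monoʳ-< Q 2≤Q (ℕ.<-trans ℕ.z<s 2≤n)))
2≤quotient {suc zero} {suc m} {n} 2≤Q 2≤n eq =
  contradiction bound (ℕ.<⇒≱ (ℕ.^-monoʳ-< (suc m) 2≤Q 2≤n))
  where
  bound : suc m ^ n ≤ suc m ^ 1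
  bound = ℕ.≤-trans (ℕ.m≤n+m∸n _ 1) (s≤s (ℕ.≤-reflexive
    (≡.trans (≡.sym eq) (≡.trans (ℕ.+-identityʳ m) (≡.sym (ℕ.*-identityʳ m))))))
2≤quotient {suc (suc N)} _ _ _ = s≤s (s≤s z≤n)

-- Sizes of the fields, the space, the linear set and its blocks

module PseudoregulusType
  {a} {q n t : ℕ} (2≤n : 2 ≤ n) (2≤t : 2 ≤ t)
  (K : CommutativeRing a a) (K-field : IsField K) (K-size : HasSize (CommutativeRing.setoid K) (q ^ t))
  (F : Subfield K) (F-size : HasSize (Subfield.asSetoid F) q)
  (V : Module K a a) (V-dim : LinearAlgebra.HasDim K V U U (2 ℕ.* n))
  (L : Pred (LinearAlgebra.Point K V) a)
  (L-type : LinearAlgebra.IsPseudoregulusType K V F q n t L)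
  where

  open CommutativeRing K hiding (zero)
  open Module V
  open LinearAlgebra K V
  open IsField K-field
  open Linear K K-field V
  open Counting ≈ᴹ-setoid
  open IsPseudoregulusType L-type
  open Subfield F using () renaming (Mem to F∋)
  private
    module F = Subfield F
    module KG = GroupProperties +-group
    module MG = GroupProperties +ᴹ-group

  Q : ℕ
  Q = q ^ t

  K-enumeration : KC.Enumeration (U {ℓ = a}) Q
  K-enumeration = KC.full-enumeration K-size

  F-enumeration : KC.Enumeration F∋ q
  F-enumeration = KC.subset-enumeration F-size

  _≟_ : ∀ x y → Dec (x ≈ y)
  x ≟ y = KC.Enumeration.≈-dec K-enumeration {x} {y} _ _

  F-minus : ∀ {x y} → F∋ x → F∋ y → F∋ (x - y)
  F-minus x∈F y∈F = F.+-closed x∈F (F.neg-closed y∈F)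

  2≤q : 2 ≤ q
  2≤q = KC.distinct⇒2≤ F-enumeration F.0-mem F.1-mem 0≉1

  2≤Q : 2 ≤ Q
  2≤Q = KC.distinct⇒2≤ K-enumeration {0#} {1#} _ _ 0≉1

  abstract
    -- Otherwise `K` would inject into `F`, although `q < q ^ t` since `t ≥ 2`.
    ∃∉F : ∃ λ c → ¬ F∋ c
    ∃∉F = case Fin.any? (λ i → ¬? (F? (elem K-enumeration i))) of λ where
        (yes (i , c∉F)) → elem K-enumeration i , c∉F
        (no none) → contradiction (Fin.injective⇒≤ {f = λ i → index F-enumeration (all∈F none i)}
          (elem-inj K-enumeration ∘ index-inj F-enumeration _ _))
          (ℕ.<⇒≱ (≡.subst (_< Q) (ℕ.^-identityʳ q) (ℕ.^-monoʳ-< q 2≤q 2≤t)))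
      where
      open KC.Enumeration
      F? : ∀ c → Dec (F∋ c)
      F? c = map′ (λ (i , c≈) → F.resp (sym c≈) (elem-∈ F-enumeration i)) (covers F-enumeration)
                  (Fin.any? (λ i → c ≟ elem F-enumeration i))
      all∈F : ¬ (∃ λ i → ¬ F∋ (elem K-enumeration i)) → ∀ i → F∋ (elem K-enumeration i)
      all∈F none i = decidable-stable (F? _) λ c∉F → none (i , c∉F)

  K-subspace-enumeration : ∀ {X} → IsSubspace U X → HasDim U X k → Enumeration X (Q ^ k)
  K-subspace-enumeration = subspace-enumeration _ K-enumeration

  abstract
    -- The size is split as a product to match a pair of complements with `Q ^ n` vectors each.
    V-enumeration : Enumeration (U {ℓ = a}) (Q ^ n ℕ.* Q ^ n)
    V-enumeration = ≡.subst (Enumeration U)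
      (≡.trans (≡.cong (λ k → Q ^ (n ℕ.+ k)) (ℕ.+-identityʳ n)) (ℕ.^-distribˡ-+-* Q n n))
      (K-subspace-enumeration _ V-dim)

  _≟ᴹ_ : ∀ v w → Dec (v ≈ᴹ w)
  v ≟ᴹ w = Enumeration.≈-dec V-enumeration {v} {w} _ _

  open Subspace W-subspace (F.neg-closed F.1-mem) using () renaming
    (resp to W-resp; 0-mem to W-0; +-closed to W-+; *-closed to W-*; minus-closed to W-minus)

  -- Rank `t * n` over F gives `W` as many vectors as an n-dimensional K-subspace has.
  W-enumeration : Enumeration W (Q ^ n)
  W-enumeration = ≡.subst (Enumeration W) (≡.sym (ℕ.^-*-assoc q t n))
    (subspace-enumeration F-minus F-enumeration W-subspace rank)

  ℓ∣_∣ : Fin N → Pred Carrierᴹ a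
  ℓ∣ i ∣ = ∣ lines i ∣

  line-subspace : ∀ i → IsSubspace U ℓ∣ i ∣
  line-subspace i = KSubspace.isSubspace (lines i)

  module ℓ (i : Fin N) = Subspace (line-subspace i) _

  line-enumeration : ∀ i → Enumeration ℓ∣ i ∣ (Q ℕ.* Q)
  line-enumeration i = ≡.subst (Enumeration _) (≡.cong (Q ℕ.*_) (ℕ.*-identityʳ Q))
    (K-subspace-enumeration (line-subspace i) (KSubspace.hasDim (lines i)))

  point-enumeration : (P : Point) → Enumeration ∣ P ∣ Q
  point-enumeration P = ≡.subst (Enumeration _) (ℕ.*-identityʳ Q)
    (K-subspace-enumeration (KSubspace.isSubspace P) (KSubspace.hasDim P))

  -- Weight `t` gives the block `Q = q ^ t` vectors, as many as a point has.
  block-enumeration : ∀ i → Enumeration (ℓ∣ i ∣ ∩ W) Q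
  block-enumeration i = subspace-enumeration F-minus F-enumeration record
    { resp     = λ v≈w (v∈ℓ , v∈W) → ℓ.resp i v≈w v∈ℓ , W-resp v≈w v∈W
    ; 0-mem    = ℓ.0-mem i , W-0
    ; +-closed = λ (v∈ℓ , v∈W) (w∈ℓ , w∈W) → ℓ.+-closed i v∈ℓ w∈ℓ , W-+ v∈W w∈W
    ; *-closed = λ {c} c∈F (v∈ℓ , v∈W) → ℓ.*-closed i {c} _ v∈ℓ , W-* c∈F v∈W
    } (lines-weight i)

  -- Partitions by the lines

  lines-meet-trivially : ∀ {i j v} → i ≢ j → ℓ∣ i ∣ v → ℓ∣ j ∣ v → v ≈ᴹ 0ᴹ
  lines-meet-trivially {i} {j} {v} i≢j v∈i v∈j with v ≟ᴹ 0ᴹ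
  ... | yes v≈0 = v≈0
  ... | no  v≉0 = ⊥-elim (lines-disjoint i j i≢j (point _≟_ v v≉0)
    (⟨⟩-⊆ (line-subspace i) v∈i , ⟨⟩-⊆ (line-subspace j) v∈j))

  N-spec′ : N ℕ.* (Q ∸ 1) ≡ Q ^ n ∸ 1
  N-spec′ = ≡.trans N-spec (≡.cong (_∸ 1)
    (≡.trans (≡.cong (q ^_) (ℕ.*-comm n t)) (≡.sym (ℕ.^-*-assoc q t n))))

  abstract
    -- `N` sets of `Q - 1` nonzero vectors on disjoint lines make `Q ^ n - 1` in all, the number of
    -- nonzero vectors of `Y`. This serves both for the blocks of `W` and for the points of a
    -- transversal.
    spread : {Y : Pred Carrierᴹ a} (X : Fin N → Pred Carrierᴹ a) → Enumeration Y (Q ^ n) →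
             (∀ i → Enumeration (X i) Q) → (∀ i → X i ⊆ Y) → (∀ i → X i ⊆ ℓ∣ i ∣) →
             (∀ i {x y} → x ≈ᴹ y → X i x → X i y) → (∀ i → X i 0ᴹ) → Y 0ᴹ →
             ∀ {y} → Y y → NonZeroᴹ y → ∃ λ i → ℓ∣ i ∣ y
    spread X EY EX X⊆Y X⊆ℓ X-resp 0∈X 0∈Y y∈Y y≉0 =
      let i , y∈Xi = blocks-cover X (≡.subst (Enumeration _) size EY)
                       (λ i → ≡.subst (Enumeration _) (≡.sym Q≡) (EX i))
                       X⊆Y X-resp 0∈Y 0∈X
                       (λ i≢j x∈i x∈j → lines-meet-trivially i≢j (X⊆ℓ _ x∈i) (X⊆ℓ _ x∈j)) y∈Y y≉0
      in i , X⊆ℓ i y∈Xi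
      where
      instance
        Q≢0 : ℕ.NonZero Q
        Q≢0 = ℕ.>-nonZero (ℕ.<-trans ℕ.z<s 2≤Q)
      Q≡ : suc (Q ∸ 1) ≡ Q
      Q≡ = ℕ.suc-pred Q
      size : Q ^ n ≡ suc (N ℕ.* (Q ∸ 1))
      size = ≡.sym (≡.trans (≡.cong suc N-spec′) (ℕ.suc-pred (Q ^ n) {{ℕ.m^n≢0 Q n}}))

  W-covered : ∀ {w} → W w → NonZeroᴹ w → ∃ λ i → ℓ∣ i ∣ w
  W-covered = spread (λ i → ℓ∣ i ∣ ∩ W) W-enumeration block-enumeration
    (λ _ → proj₂) (λ _ → proj₁)
    (λ i v≈w (v∈ℓ , v∈W) → ℓ.resp i v≈w v∈ℓ , W-resp v≈w v∈W) (λ i → ℓ.0-mem i , W-0) W-0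

  2≤N : 2 ≤ N
  2≤N = 2≤quotient 2≤Q 2≤n N-spec′

  abstract
    other-line : ∀ (i : Fin N) → ∃ λ j → j ≢ i
    other-line i with i Fin.≟ fromℕ< (ℕ.<⇒≤ 2≤N)
    ... | no  i≢0 = _ , i≢0 ∘ ≡.sym
    ... | yes i≡0 = fromℕ< 2≤N , λ 1≡i → case
      Fin.fromℕ<-injective 1 0 2≤N (ℕ.<⇒≤ 2≤N) (≡.trans 1≡i i≡0) of λ ()

    block-nonzero : ∀ i → ∃ λ w → (ℓ∣ i ∣ w × W w) × NonZeroᴹ w
    block-nonzero i = 2≤⇒other (block-enumeration i) 2≤Q (ℓ.0-mem i , W-0)

  ⟨W⟩∈L : ∀ {w} → W w → (w≉0 : NonZeroᴹ w) → L (point _≟_ w w≉0)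
  ⟨W⟩∈L w∈W w≉0 = proj₂ L≐L_W (_ , w∈W , w≉0 , (λ x → x) , (λ x → x))

  -- Scatteredness makes `w` and `c *ₗ w` F-multiples of one vector `b`, by `x` and `y` say, with
  -- `x` nonzero. Then `c` is the quotient of `y` by `x`.
  scattered-scalar : ∀ {c w} → W w → NonZeroᴹ w → W (c *ₗ w) → F∋ c
  scattered-scalar {c} {w} w∈W w≉0 cw∈W
    with b , b-basis ← scattered (point _≟_ w w≉0) (⟨W⟩∈L w∈W w≉0)
    with x , x∈F , w≈ ← IsBasis.spanning b-basis w (∈⟨⟩ w , w∈W)
    with y , y∈F , cw≈ ← IsBasis.spanning b-basis (c *ₗ w) ((c , ≈ᴹ-refl) , cw∈W) =
      F.resp yd≈c (F.*-closed (y∈F zero) (F.inv-closed (x∈F zero) xd≈1))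
    where
    w≈xb : w ≈ᴹ x zero *ₗ b zero
    w≈xb = ≈ᴹ-trans w≈ (+ᴹ-identityʳ _)
    b≉0 : NonZeroᴹ (b zero)
    b≉0 b≈0 = w≉0 (≈ᴹ-trans w≈xb (≈ᴹ-trans (*ₗ-congˡ b≈0) (*ₗ-zeroʳ _)))
    x≉0 : ¬ (x zero ≈ 0#)
    x≉0 x≈0 = w≉0 (≈ᴹ-trans w≈xb (≈ᴹ-trans (*ₗ-congʳ x≈0) (*ₗ-zeroˡ _)))
    d = proj₁ (inverse (x zero) x≉0)
    xd≈1 : x zero * d ≈ 1#
    xd≈1 = proj₂ (inverse (x zero) x≉0)
    cxb≈yb : (c * x zero) *ₗ b zero ≈ᴹ y zero *ₗ b zero
    cxb≈yb = begin
      (c * x zero) *ₗ b zero       ≈⟨ *ₗ-assoc _ _ _ ⟩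
      c *ₗ (x zero *ₗ b zero)      ≈⟨ *ₗ-congˡ w≈xb ⟨
      c *ₗ w                       ≈⟨ cw≈ ⟩
      y zero *ₗ b zero +ᴹ 0ᴹ       ≈⟨ +ᴹ-identityʳ _ ⟩
      y zero *ₗ b zero             ∎
      where open SetoidReasoning ≈ᴹ-setoid
    cx≈y : c * x zero ≈ y zero
    cx≈y = *ₗ-injectiveʳ _≟_ b≉0 cxb≈yb
    yd≈c : y zero * d ≈ c
    yd≈c = begin
      y zero * d           ≈⟨ *-congʳ cx≈y ⟨
      (c * x zero) * d     ≈⟨ *-assoc _ _ _ ⟩
      c * (x zero * d)     ≈⟨ *-congˡ xd≈1 ⟩
      c * 1#               ≈⟨ *-identityʳ c ⟩
      c                    ∎
      where open SetoidReasoning setoid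

  -- Reduction modulo one transversal

  module Transversal (T : KSubspace n) (T-trans : IsTransversal T) where
    T-subspace : IsSubspace U ∣ T ∣
    T-subspace = KSubspace.isSubspace T

    module T = Subspace T-subspace _
    open Mod T-subspace public

    W∩T : ∀ {w} → W w → ∣ T ∣ w → w ≈ᴹ 0ᴹ
    W∩T {w} w∈W w∈T with w ≟ᴹ 0ᴹ
    ... | yes w≈0 = w≈0
    ... | no  w≉0 = ⊥-elim
      (proj₁ T-trans (point _≟_ w w≉0) (⟨W⟩∈L w∈W w≉0) (⟨⟩-⊆ T-subspace w∈T))

    W-~⇒≈ : ∀ {v w} → W v → W w → v ~ w [mod ∣ T ∣ ] → v ≈ᴹ w
    W-~⇒≈ v∈W w∈W v~w = MG.x∙y⁻¹≈ε⇒x≈y _ _ (W∩T (W-minus v∈W w∈W) v~w)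

    T-enumeration : Enumeration ∣ T ∣ (Q ^ n)
    T-enumeration = K-subspace-enumeration T-subspace (KSubspace.hasDim T)

    -- `W` and `T` meet trivially and have `Q ^ n` vectors each, so every class modulo `T` has a
    -- representative in `W`.
    W-complement : ∀ v → ∃ λ w → W w × v ~ w [mod ∣ T ∣ ]
    W-complement v = complement-by-counting {Y = U} T-subspace _ W-enumeration T-enumeration
      V-enumeration _ _ W-~⇒≈ {v} _

    P : Fin N → Point
    P i = proj₁ (proj₂ T-trans i)

    P⊆T : ∀ i → ∣ P i ∣ ⊆ ∣ T ∣
    P⊆T i = proj₁ (proj₂ (proj₂ T-trans i))

    P⊆ℓ : ∀ i → ∣ P i ∣ ⊆ ℓ∣ i ∣
    P⊆ℓ i = proj₂ (proj₂ (proj₂ T-trans i))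

    T-covered : ∀ {v} → ∣ T ∣ v → NonZeroᴹ v → ∃ λ i → ℓ∣ i ∣ v
    T-covered = spread (λ i → ∣ P i ∣) T-enumeration (point-enumeration ∘ P) P⊆T P⊆ℓ
      (λ i → IsSubspace.resp (KSubspace.isSubspace (P i)))
      (λ i → IsSubspace.0-mem (KSubspace.isSubspace (P i))) T.0-mem

    -- The block and the point `P i` have `Q` vectors each, the line has `Q * Q`. So the
    -- representative in `W` of a vector of the line stays on the line.
    block-complement : ∀ i {v} → ℓ∣ i ∣ v → ∃ λ w → (ℓ∣ i ∣ w × W w) × v ~ w [mod ∣ T ∣ ]
    block-complement i v∈ℓ =
      let w , w∈ , v~w = complement-by-counting (KSubspace.isSubspace (P i)) (line-subspace i)
            (block-enumeration i) (point-enumeration (P i)) (line-enumeration i)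
            proj₁ (P⊆ℓ i) (λ (_ , v∈W) (_ , w∈W) → W-~⇒≈ v∈W w∈W ∘ P⊆T i) v∈ℓ
      in w , w∈ , P⊆T i v~w

    -- A nonzero `c - d` could be inverted, which would put `w` itself into `T`.
    ~⇒≈-scalar : ∀ {c d w} → W w → NonZeroᴹ w → c *ₗ w ~ d *ₗ w [mod ∣ T ∣ ] → c ≈ d
    ~⇒≈-scalar {c} {d} {w} w∈W w≉0 cw~dw with (c - d) ≟ 0#
    ... | yes c-d≈0 = KG.x∙y⁻¹≈ε⇒x≈y c d c-d≈0
    ... | no  c-d≉0 with e , c-d*e≈1 ← inverse (c - d) c-d≉0 = contradiction (W∩T w∈W w∈T) w≉0
      where
      open SetoidReasoning ≈ᴹ-setoid
      w∈T : ∣ T ∣ w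
      w∈T = T.resp (begin
        e *ₗ (c *ₗ w -ᴹ d *ₗ w)         ≈⟨ *ₗ-congˡ (*ₗ-distribʳ-minus c d w) ⟨
        e *ₗ ((c - d) *ₗ w)             ≈⟨ *ₗ-assoc e (c - d) w ⟨
        (e * (c - d)) *ₗ w              ≈⟨ *ₗ-congʳ (trans (*-comm _ _) c-d*e≈1) ⟩
        1# *ₗ w                         ≈⟨ *ₗ-identityˡ w ⟩
        w                               ∎) (T.*-closed {e} _ cw~dw)

    ⟨⟩-~⇒≈ : ∀ {w x y} → W w → NonZeroᴹ w → ⟨ w ⟩ x → ⟨ w ⟩ y → x ~ y [mod ∣ T ∣ ] → x ≈ᴹ y
    ⟨⟩-~⇒≈ w∈W w≉0 (c , x≈cw) (d , y≈dw) x~y = ≈ᴹ-trans x≈cw (≈ᴹ-trans (*ₗ-congʳ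
      (~⇒≈-scalar w∈W w≉0 (~-trans (≈⇒~ (≈ᴹ-sym x≈cw)) (~-trans x~y (≈⇒~ y≈dw))))) (≈ᴹ-sym y≈dw))

    -- Counting again: the points `⟨ w ⟩` and `⟨ p ⟩` fill the line. The congruence is kept modulo
    -- `⟨ p ⟩`, finer than modulo `T`, because collinearity with `p` is derived from it.
    line-spanned : ∀ i {w p} → W w → ℓ∣ i ∣ w → NonZeroᴹ w → ∣ T ∣ p → ℓ∣ i ∣ p → NonZeroᴹ p →
                   ∀ {v} → ℓ∣ i ∣ v → ∃ λ c → v ~ c *ₗ w [mod ⟨ p ⟩ ]
    line-spanned i {w} {p} w∈W w∈ℓ w≉0 p∈T p∈ℓ p≉0 v∈ℓ =
      let x , (c , x≈cw) , v~x = complement-by-counting (⟨⟩-subspace p) (line-subspace i)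
            (point-enumeration (point _≟_ w w≉0)) (point-enumeration (point _≟_ p p≉0))
            (line-enumeration i) (⟨⟩-⊆ (line-subspace i) w∈ℓ) (⟨⟩-⊆ (line-subspace i) p∈ℓ)
            (λ x∈ y∈ → ⟨⟩-~⇒≈ w∈W w≉0 x∈ y∈ ∘ ⟨⟩-⊆ T-subspace p∈T) v∈ℓ
      in c , Mod.~-trans (⟨⟩-subspace p) v~x (Mod.≈⇒~ (⟨⟩-subspace p) x≈cw)

    P-nonzero : ∀ i → ∃ λ p → ∣ P i ∣ p × NonZeroᴹ p
    P-nonzero i = 2≤⇒other (point-enumeration (P i)) 2≤Q
      (IsSubspace.0-mem (KSubspace.isSubspace (P i)))

    -- Modulo `T` the line collapses to dimension one over `K`, because it contains a point of `T`.
    line-scalar : ∀ i {w} → W w → ℓ∣ i ∣ w → NonZeroᴹ w → ∀ {v} → ℓ∣ i ∣ v →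
                  ∃ λ c → v ~ c *ₗ w [mod ∣ T ∣ ]
    line-scalar i w∈W w∈ℓ w≉0 v∈ℓ =
      let p , p∈P , p≉0 = P-nonzero i
          c , v~cw = line-spanned i w∈W w∈ℓ w≉0 (P⊆T i p∈P) (P⊆ℓ i p∈P) p≉0 v∈ℓ
      in c , ⟨⟩-⊆ T-subspace (P⊆T i p∈P) v~cw

    -- The line is not inside `T`, as its block vector `w` is not. With `v` and `p` in `T`, the
    -- multiple `c *ₗ w` congruent to `v` modulo `⟨ p ⟩` lies in `T`, so `c` vanishes.
    T∩ℓ-collinear : ∀ i {p v} → ∣ T ∣ p → ℓ∣ i ∣ p → NonZeroᴹ p → ∣ T ∣ v → ℓ∣ i ∣ v → ⟨ p ⟩ v
    T∩ℓ-collinear i {p} {v} p∈T p∈ℓ p≉0 v∈T v∈ℓ =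
      let w , (w∈ℓ , w∈W) , w≉0 = block-nonzero i
          c , v~cw = line-spanned i w∈W w∈ℓ w≉0 p∈T p∈ℓ p≉0 v∈ℓ
          cw~0 = ~-trans (~-sym (⟨⟩-⊆ T-subspace p∈T v~cw)) (∈⇒~0 v∈T)
          c≈0 = ~⇒≈-scalar w∈W w≉0 (~-trans cw~0 (≈⇒~ (≈ᴹ-sym (*ₗ-zeroˡ w))))
      in Mod.~0⇒∈ (⟨⟩-subspace p) (Mod.~-trans (⟨⟩-subspace p) v~cw
           (Mod.≈⇒~ (⟨⟩-subspace p) (≈ᴹ-trans (*ₗ-congʳ c≈0) (*ₗ-zeroˡ w))))

    -- The block supplies a representative of `v` on the line, and representatives in `W` are
    -- unique.
    ~W⇒∈ℓ : ∀ i {v w} → ℓ∣ i ∣ v → W w → v ~ w [mod ∣ T ∣ ] → ℓ∣ i ∣ w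
    ~W⇒∈ℓ i v∈ℓ w∈W v~w =
      let w′ , (w′∈ℓ , w′∈W) , v~w′ = block-complement i v∈ℓ
      in ℓ.resp i (W-~⇒≈ w′∈W w∈W (~-trans (~-sym v~w′) v~w)) w′∈ℓ

    -- The representative in `W` of the common class lies on both lines, so it is zero. Distinct
    -- lines are thus independent modulo `T`.
    ~⇒zero-scalar : ∀ {i j c d v w} → i ≢ j → W v → ℓ∣ i ∣ v → NonZeroᴹ v → W w → ℓ∣ j ∣ w →
                    c *ₗ v ~ d *ₗ w [mod ∣ T ∣ ] → c ≈ 0#
    ~⇒zero-scalar {i} {j} {c} {d} {v} i≢j v∈W v∈ℓ v≉0 w∈W w∈ℓ cv~dw =
      let x , (x∈ℓ , x∈W) , cv~x = block-complement i (ℓ.*-closed i {c} _ v∈ℓ)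
          x∈ℓj = ~W⇒∈ℓ j (ℓ.*-closed j {d} _ w∈ℓ) x∈W (~-trans (~-sym cv~dw) cv~x)
          x≈0 = lines-meet-trivially i≢j x∈ℓ x∈ℓj
      in ~⇒≈-scalar v∈W v≉0 (~-trans cv~x (≈⇒~ (≈ᴹ-trans x≈0 (≈ᴹ-sym (*ₗ-zeroˡ v)))))

  -- Two scalar multiplications on W compared

  module TransversalPair (T T′ : KSubspace n) (T-trans : IsTransversal T) (T′-trans : IsTransversal T′) where
    private
      module T  = Transversal T T-trans
      module T′ = Transversal T′ T′-trans

    -- c w in the K-structure of V/T′ equals d w in that of V/T, both transported to W; for w ≉ 0
    -- the relation is the graph of σ, independently of w.
    _⇝_at_ : Carrier → Carrier → Pred Carrierᴹ a
    c ⇝ d at w = ∃ λ y → W y × c *ₗ w ~ y [mod ∣ T′ ∣ ] × d *ₗ w ~ y [mod ∣ T ∣ ]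

    ⇝-respʳ : ∀ {c d d′ w} → d ≈ d′ → c ⇝ d at w → c ⇝ d′ at w
    ⇝-respʳ d≈d′ (y , y∈W , cw~y , dw~y) =
      y , y∈W , cw~y , T.~-trans (T.≈⇒~ (*ₗ-congʳ (sym d≈d′))) dw~y

    ⇝-respˡ : ∀ {c c′ d w} → c ≈ c′ → c ⇝ d at w → c′ ⇝ d at w
    ⇝-respˡ c≈c′ (y , y∈W , cw~y , dw~y) =
      y , y∈W , T′.~-trans (T′.≈⇒~ (*ₗ-congʳ (sym c≈c′))) cw~y , dw~y

    abstract
      -- The representative `y` modulo `T′` stays on the line of `w`, and modulo `T` every vector of
      -- that line is a multiple of `w`.
      ⇝-total : ∀ {w} → W w → NonZeroᴹ w → ∀ c → ∃ λ d → c ⇝ d at w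
      ⇝-total w∈W w≉0 c =
        let i , w∈ℓ = W-covered w∈W w≉0
            y , (y∈ℓ , y∈W) , cw~y = T′.block-complement i (ℓ.*-closed i {c} _ w∈ℓ)
            d , y~dw = T.line-scalar i w∈W w∈ℓ w≉0 y∈ℓ
        in d , y , y∈W , cw~y , T.~-sym y~dw

    -- `y` is determined by `c` because `W` meets `T′` trivially, and `d` by `y` because the nonzero
    -- `w` is not in `T`.
    ⇝-unique : ∀ {c d d′ w} → W w → NonZeroᴹ w → c ⇝ d at w → c ⇝ d′ at w → d ≈ d′
    ⇝-unique w∈W w≉0 (y , y∈W , cw~y , dw~y) (y′ , y′∈W , cw~y′ , d′w~y′) =
      T.~⇒≈-scalar w∈W w≉0 (T.~-trans dw~y (T.~-trans (T.≈⇒~ y≈y′) (T.~-sym d′w~y′)))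
      where y≈y′ = T′.W-~⇒≈ y∈W y′∈W (T′.~-trans (T′.~-sym cw~y) cw~y′)

    ⇝-at-0 : ∀ c d {w} → w ≈ᴹ 0ᴹ → c ⇝ d at w
    ⇝-at-0 c d w≈0 = 0ᴹ , W-0 , T′.≈⇒~ (c*w≈0 c) , T.≈⇒~ (c*w≈0 d)
      where
      c*w≈0 : ∀ c → c *ₗ _ ≈ᴹ 0ᴹ
      c*w≈0 c = ≈ᴹ-trans (*ₗ-congˡ w≈0) (*ₗ-zeroʳ c)

    -- If c ⇝ d at v, c ⇝ d′ at w and c ⇝ e at v + w, then (d - e) v ≡ (e - d′) w modulo T.
    ⇝-other-line : ∀ {i j c d v w} → i ≢ j → W v → ℓ∣ i ∣ v → NonZeroᴹ v → W w → ℓ∣ j ∣ w → NonZeroᴹ w →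
                   c ⇝ d at v → c ⇝ d at w
    ⇝-other-line {i} {j} {c} {d} {v} {w} i≢j v∈W v∈ℓ v≉0 w∈W w∈ℓ w≉0 cdv@(x , x∈W , cv~x , dv~x) =
      ⇝-respʳ (trans (sym e≈d′) (sym d≈e)) cd′w
      where
      cd′w-∃ = ⇝-total w∈W w≉0 c
      d′ = proj₁ cd′w-∃
      cd′w = proj₂ cd′w-∃
      y = proj₁ cd′w
      y∈W = proj₁ (proj₂ cd′w)
      cw~y = proj₁ (proj₂ (proj₂ cd′w))
      d′w~y = proj₂ (proj₂ (proj₂ cd′w))

      v+w≉0 : NonZeroᴹ (v +ᴹ w)
      v+w≉0 v+w≈0 = v≉0 (lines-meet-trivially i≢j v∈ℓ
        (ℓ.resp j (≈ᴹ-sym (MG.inverseˡ-unique v w v+w≈0)) (ℓ.neg-closed j w∈ℓ)))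

      cevw-∃ = ⇝-total (W-+ v∈W w∈W) v+w≉0 c
      e = proj₁ cevw-∃
      z = proj₁ (proj₂ cevw-∃)
      z∈W = proj₁ (proj₂ (proj₂ cevw-∃))
      cvw~z = proj₁ (proj₂ (proj₂ (proj₂ cevw-∃)))
      evw~z = proj₂ (proj₂ (proj₂ (proj₂ cevw-∃)))

      x+y≈z : x +ᴹ y ≈ᴹ z
      x+y≈z = T′.W-~⇒≈ (W-+ x∈W y∈W) z∈W (begin
        x +ᴹ y              ≈⟨ T′.+-cong-~ cv~x cw~y ⟨
        c *ₗ v +ᴹ c *ₗ w    ≈⟨ T′.≈⇒~ (*ₗ-distribˡ c v w) ⟨
        c *ₗ (v +ᴹ w)       ≈⟨ cvw~z ⟩
        z                   ∎)
        where open SetoidReasoning T′.mod-setoid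

      dv+d′w~ev+ew : d *ₗ v +ᴹ d′ *ₗ w ~ e *ₗ v +ᴹ e *ₗ w [mod ∣ T ∣ ]
      dv+d′w~ev+ew = begin
        d *ₗ v +ᴹ d′ *ₗ w    ≈⟨ T.+-cong-~ dv~x d′w~y ⟩
        x +ᴹ y               ≈⟨ T.≈⇒~ x+y≈z ⟩
        z                    ≈⟨ evw~z ⟨
        e *ₗ (v +ᴹ w)        ≈⟨ T.≈⇒~ (*ₗ-distribˡ e v w) ⟩
        e *ₗ v +ᴹ e *ₗ w     ∎
        where open SetoidReasoning T.mod-setoid

      [d-e]v~[e-d′]w : (d - e) *ₗ v ~ (e - d′) *ₗ w [mod ∣ T ∣ ]
      [d-e]v~[e-d′]w = begin
        (d - e) *ₗ v             ≈⟨ T.≈⇒~ (*ₗ-distribʳ-minus d e v) ⟩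
        d *ₗ v -ᴹ e *ₗ v         ≈⟨ T.+-cancel-~ dv+d′w~ev+ew ⟩
        e *ₗ w -ᴹ d′ *ₗ w        ≈⟨ T.≈⇒~ (*ₗ-distribʳ-minus e d′ w) ⟨
        (e - d′) *ₗ w            ∎
        where open SetoidReasoning T.mod-setoid

      -- Vectors of distinct lines are independent modulo `T`, so both coefficients in
      -- `[d-e]v~[e-d′]w` vanish.
      d≈e : d ≈ e
      d≈e = KG.x∙y⁻¹≈ε⇒x≈y d e (T.~⇒zero-scalar i≢j v∈W v∈ℓ v≉0 w∈W w∈ℓ [d-e]v~[e-d′]w)

      e≈d′ : e ≈ d′
      e≈d′ = KG.x∙y⁻¹≈ε⇒x≈y e d′
        (T.~⇒zero-scalar (i≢j ∘ ≡.sym) w∈W w∈ℓ w≉0 v∈W v∈ℓ (T.~-sym [d-e]v~[e-d′]w))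

    -- Vectors on different lines are compared directly; two vectors of one line are compared
    -- through a block vector `u` of a second line.
    ⇝-everywhere : ∀ {c d v} → W v → NonZeroᴹ v → c ⇝ d at v → ∀ {w} → W w → c ⇝ d at w
    ⇝-everywhere {c} {d} v∈W v≉0 cdv {w} w∈W with w ≟ᴹ 0ᴹ
    ... | yes w≈0 = ⇝-at-0 c d w≈0
    ... | no  w≉0
      with i , v∈ℓ ← W-covered v∈W v≉0
      with j , w∈ℓ ← W-covered w∈W w≉0
      with i Fin.≟ j
    ... | no  i≢j = ⇝-other-line i≢j v∈W v∈ℓ v≉0 w∈W w∈ℓ w≉0 cdv
    ... | yes i≡j =
      let k , k≢i = other-line i
          u , (u∈ℓ , u∈W) , u≉0 = block-nonzero k
      in ⇝-other-line (λ k≡j → k≢i (≡.trans k≡j (≡.sym i≡j))) u∈W u∈ℓ u≉0 w∈W w∈ℓ w≉0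
           (⇝-other-line (k≢i ∘ ≡.sym) v∈W v∈ℓ v≉0 u∈W u∈ℓ u≉0 cdv)

    -- On the line through p both reductions into W are projections along ⟨ p ⟩.
    common⇒⇝-refl : ∀ {p} → ∣ T ∣ p → ∣ T′ ∣ p → NonZeroᴹ p → ∀ c {w} → W w → c ⇝ c at w
    common⇒⇝-refl p∈T p∈T′ p≉0 c =
      let i , p∈ℓ = T.T-covered p∈T p≉0
          u , (u∈ℓ , u∈W) , u≉0 = block-nonzero i
          y , (y∈ℓ , y∈W) , cu~y = T.block-complement i (ℓ.*-closed i {c} _ u∈ℓ)
          cu-y∈⟨p⟩ = T.T∩ℓ-collinear i p∈T p∈ℓ p≉0 cu~y (ℓ.minus-closed i (ℓ.*-closed i {c} _ u∈ℓ) y∈ℓ)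
      in ⇝-everywhere u∈W u≉0 (y , y∈W , ⟨⟩-⊆ T′.T-subspace p∈T′ cu-y∈⟨p⟩ , cu~y)

    -- For c ∉ F the nonzero vector c w - y spans the point in which T meets the line of w.
    ⇝-refl⇒⊆ : (∀ c {w} → W w → c ⇝ c at w) → ∣ T ∣ ⊆ ∣ T′ ∣
    ⇝-refl⇒⊆ ⇝-refl {v} v∈T with v ≟ᴹ 0ᴹ
    ... | yes v≈0 = T′.T.resp (≈ᴹ-sym v≈0) T′.T.0-mem
    ... | no  v≉0 =
      let i , v∈ℓ = T.T-covered v∈T v≉0
          w , (w∈ℓ , w∈W) , w≉0 = block-nonzero i
          c , c∉F = ∃∉F
          y , y∈W , cw~′y , cw~y = ⇝-refl c w∈W
          cw∈ℓ = ℓ.*-closed i {c} _ w∈ℓ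
          y∈ℓ = T.~W⇒∈ℓ i cw∈ℓ y∈W cw~y
          cw-y≉0 = λ cw-y≈0 → c∉F (scattered-scalar w∈W w≉0
            (W-resp (≈ᴹ-sym (MG.x∙y⁻¹≈ε⇒x≈y _ _ cw-y≈0)) y∈W))
      in ⟨⟩-⊆ T′.T-subspace cw~′y
           (T.T∩ℓ-collinear i cw~y (ℓ.minus-closed i cw∈ℓ y∈ℓ) cw-y≉0 v∈T v∈ℓ)

  -- Trivial intersection of the two transversals

  private
    module T₁ = Transversal T₁ T₁-transversal
    module T₂ = Transversal T₂ T₂-transversal
    module TP  = TransversalPair T₁ T₂ T₁-transversal T₂-transversal
    module TP′ = TransversalPair T₂ T₁ T₂-transversal T₁-transversal
  open TP

  -- In `TP` the left scalar acts modulo `T₂` and the right one modulo `T₁`; in `TP′` the roles are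
  -- reversed. Totality and uniqueness in `TP′` thus yield surjectivity and injectivity of `σ`.
  ⇝-swap : ∀ {c d w} → c TP.⇝ d at w → d TP′.⇝ c at w
  ⇝-swap (y , y∈W , cw~y , dw~y) = y , y∈W , dw~y , cw~y

  -- Reflexivity of the relation survives the exchange of the transversals, so a common nonzero
  -- vector would give both inclusions.
  T₁∩T₂ : ∀ {v} → ∣ T₁ ∣ v → ∣ T₂ ∣ v → v ≈ᴹ 0ᴹ
  T₁∩T₂ {v} v∈T₁ v∈T₂ with v ≟ᴹ 0ᴹ
  ... | yes v≈0 = v≈0
  ... | no  v≉0 = ⊥-elim (T₁≢T₂ (TP.⇝-refl⇒⊆ ⇝-refl , TP′.⇝-refl⇒⊆ (λ c → ⇝-swap ∘ ⇝-refl c)))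
    where
    ⇝-refl : ∀ c {w} → W w → c TP.⇝ c at w
    ⇝-refl = common⇒⇝-refl v∈T₁ v∈T₂ v≉0

  ~₁∧~₂⇒≈ : ∀ {v w} → v ~ w [mod ∣ T₁ ∣ ] → v ~ w [mod ∣ T₂ ∣ ] → v ≈ᴹ w
  ~₁∧~₂⇒≈ v~₁w v~₂w = MG.x∙y⁻¹≈ε⇒x≈y _ _ (T₁∩T₂ v~₁w v~₂w)

  -- The companion automorphism and its fixed field

  base : ∃ λ w → (ℓ∣ fromℕ< (ℕ.<⇒≤ 2≤N) ∣ w × W w) × NonZeroᴹ w
  base = block-nonzero _

  w₀ : Carrierᴹ
  w₀ = proj₁ base

  w₀∈W : W w₀
  w₀∈W = proj₂ (proj₁ (proj₂ base))

  w₀≉0 : NonZeroᴹ w₀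
  w₀≉0 = proj₂ (proj₂ base)

  -- Read off at the arbitrarily chosen `w₀`; `⇝-everywhere` carries it to all of `W`.
  σ : Carrier → Carrier
  σ c = proj₁ (⇝-total w₀∈W w₀≉0 c)

  ⇝σ₀ : ∀ c → c ⇝ σ c at w₀
  ⇝σ₀ c = proj₂ (⇝-total w₀∈W w₀≉0 c)

  ⇝σ : ∀ c {w} → W w → c ⇝ σ c at w
  ⇝σ c = ⇝-everywhere w₀∈W w₀≉0 (⇝σ₀ c)

  σ-unique : ∀ {c d} → c ⇝ d at w₀ → σ c ≈ d
  σ-unique {c} = ⇝-unique w₀∈W w₀≉0 (⇝σ₀ c)

  -- `c *ₗ w` is already in `W`, hence its own representative modulo both transversals.
  F⇒⇝-refl : ∀ {c w} → F∋ c → W w → c ⇝ c at w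
  F⇒⇝-refl c∈F w∈W = _ , W-* c∈F w∈W , T₂.≈⇒~ ≈ᴹ-refl , T₁.≈⇒~ ≈ᴹ-refl

  σ-cong : ∀ {c d} → c ≈ d → σ c ≈ σ d
  σ-cong {c} {d} c≈d = σ-unique (⇝-respˡ (sym c≈d) (⇝σ₀ d))

  σ-+ : ∀ c d → σ (c + d) ≈ σ c + σ d
  σ-+ c d =
    let x , x∈W , cw~x , σcw~x = ⇝σ₀ c
        y , y∈W , dw~y , σdw~y = ⇝σ₀ d
    in σ-unique (x +ᴹ y , W-+ x∈W y∈W ,
         T₂.~-trans (T₂.≈⇒~ (*ₗ-distribʳ w₀ c d)) (T₂.+-cong-~ cw~x dw~y) ,
         T₁.~-trans (T₁.≈⇒~ (*ₗ-distribʳ w₀ _ _)) (T₁.+-cong-~ σcw~x σdw~y))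

  σ-neg : ∀ c → σ (- c) ≈ - σ c
  σ-neg c = KG.inverseˡ-unique _ _ (begin
    σ (- c) + σ c    ≈⟨ σ-+ (- c) c ⟨
    σ (- c + c)      ≈⟨ σ-cong (-‿inverseˡ c) ⟩
    σ 0#             ≈⟨ σ-unique (F⇒⇝-refl F.0-mem w₀∈W) ⟩
    0#               ∎)
    where open SetoidReasoning setoid

  σ-* : ∀ c d → σ (c * d) ≈ σ c * σ d
  σ-* c d =
    let x , x∈W , dw~x , σdw~x = ⇝σ₀ d
        -- Here the relation is needed at `x` instead of `w₀`: multiplicativity rests on the
        -- independence of the base vector.
        y , y∈W , cx~y , σcx~y = ⇝σ c x∈W
    in σ-unique (y , y∈W ,
         T₂.~-trans (T₂.≈⇒~ (*ₗ-assoc c d w₀)) (T₂.~-trans (T₂.*-cong-~ c dw~x) cx~y) ,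
         T₁.~-trans (T₁.≈⇒~ (*ₗ-assoc _ _ w₀)) (T₁.~-trans (T₁.*-cong-~ (σ c) σdw~x) σcx~y))

  σ-injective : ∀ {c d} → σ c ≈ σ d → c ≈ d
  σ-injective {c} {d} σc≈σd = TP′.⇝-unique w₀∈W w₀≉0 (⇝-swap (⇝σ₀ c)) (⇝-swap (⇝-respʳ (sym σc≈σd) (⇝σ₀ d)))

  σ-automorphism : IsAutomorphism σ
  σ-automorphism = record
    { isRingMonomorphism = record
      { isRingHomomorphism = record
        { isSemiringHomomorphism = record
          { isNearSemiringHomomorphism = record
            { +-isMonoidHomomorphism = record
              { isMagmaHomomorphism = record
                { isRelHomomorphism = record { cong = σ-cong }
                ; homo = σ-+
                }
              ; ε-homo = σ-unique (F⇒⇝-refl F.0-mem w₀∈W)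
              }
            ; *-homo = σ-*
            }
          ; 1#-homo = σ-unique (F⇒⇝-refl F.1-mem w₀∈W)
          }
        ; -‿homo = σ-neg
        }
      ; injective = σ-injective
      }
    ; surjective = λ d →
        let c , y , y∈W , dw~y , cw~y = TP′.⇝-total w₀∈W w₀≉0 d in
        c , λ e≈c → σ-unique (⇝-respˡ (sym e≈c) (y , y∈W , cw~y , dw~y))
    }

  -- For a fixed `c` some vector of `W` is congruent to `c *ₗ w₀` modulo both transversals, so it
  -- equals `c *ₗ w₀`, and scatteredness puts `c` into F.
  Fix-σ≐F : (λ c → σ c ≈ c) ≐ F∋
  Fix-σ≐F = fixed⇒F , λ c∈F → σ-unique (F⇒⇝-refl c∈F w₀∈W)
    where
    fixed⇒F : ∀ {c} → σ c ≈ c → F∋ c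
    fixed⇒F {c} σc≈c =
      let y , y∈W , cw~₂y , cw~₁y = ⇝-respʳ σc≈c (⇝σ₀ c)
      in scattered-scalar w₀∈W w₀≉0 (W-resp (≈ᴹ-sym (~₁∧~₂⇒≈ cw~₁y cw~₂y)) y∈W)

  -- The direct sum and the semilinear map with graph W

  T₁⊕T₂ : IsDirectSum T₁ T₂
  T₁⊕T₂ = record
    { decompose = λ v →
        let u , u∈T₁ , v~u = complement-by-counting {Y = U} T₂.T-subspace _ T₁.T-enumeration
              T₂.T-enumeration V-enumeration _ _
              (λ x∈T₁ y∈T₁ → ~₁∧~₂⇒≈ (T₁.T.minus-closed x∈T₁ y∈T₁)) {v} _
        in u , v -ᴹ u , u∈T₁ , v~u , ≈ᴹ-sym (+ᴹ-minus u v)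
    ; trivial = λ v → T₁∩T₂
    }

  -- `u +ᴹ v` is the representative of `u` in `W` modulo `T₂`.
  graph-∃ : ∀ u → ∃ λ v → ∣ T₂ ∣ v × W (u +ᴹ v)
  graph-∃ u =
    let w , w∈W , u~w = T₂.W-complement u
    in w -ᴹ u , T₂.~-sym u~w , W-resp (≈ᴹ-sym (+ᴹ-minus u w)) w∈W

  graph-unique : ∀ {u u′ v v′} → u ≈ᴹ u′ → ∣ T₂ ∣ v → ∣ T₂ ∣ v′ → W (u +ᴹ v) → W (u′ +ᴹ v′) → v ≈ᴹ v′
  graph-unique {u} {u′} {v} {v′} u≈u′ v∈T₂ v′∈T₂ uv∈W u′v′∈W =
    MG.∙-cancelˡ u _ _ (≈ᴹ-trans (T₂.W-~⇒≈ uv∈W u′v′∈W uv~u′v′) (+ᴹ-congʳ (≈ᴹ-sym u≈u′)))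
    where
    uv~u′v′ : u +ᴹ v ~ u′ +ᴹ v′ [mod ∣ T₂ ∣ ]
    uv~u′v′ = T₂.+-cong-~ (T₂.≈⇒~ u≈u′) (T₂.~-trans (T₂.∈⇒~0 v∈T₂) (T₂.~-sym (T₂.∈⇒~0 v′∈T₂)))

  graph-injective : ∀ {u u′ v v′} → ∣ T₁ ∣ u → ∣ T₁ ∣ u′ → v ≈ᴹ v′ → W (u +ᴹ v) → W (u′ +ᴹ v′) → u ≈ᴹ u′
  graph-injective {u} {u′} {v} {v′} u∈T₁ u′∈T₁ v≈v′ uv∈W u′v′∈W =
    MG.∙-cancelʳ v _ _ (≈ᴹ-trans (T₁.W-~⇒≈ uv∈W u′v′∈W uv~u′v′) (+ᴹ-congˡ (≈ᴹ-sym v≈v′)))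
    where
    uv~u′v′ : u +ᴹ v ~ u′ +ᴹ v′ [mod ∣ T₁ ∣ ]
    uv~u′v′ = T₁.+-cong-~ (T₁.~-trans (T₁.∈⇒~0 u∈T₁) (T₁.~-sym (T₁.∈⇒~0 u′∈T₁))) (T₁.≈⇒~ v≈v′)

  -- Take the `y` in `W` provided by `⇝σ` at `u +ᴹ v`. Modulo `T₂` it is `c` times that sum, so its
  -- `T₁`-component is `c *ₗ u`; modulo `T₁` it is `σ c` times the sum, so its `T₂`-component is
  -- `σ c *ₗ v`.
  graph-semilinear : ∀ c {u v} → ∣ T₁ ∣ u → ∣ T₂ ∣ v → W (u +ᴹ v) → W (c *ₗ u +ᴹ σ c *ₗ v)
  graph-semilinear c {u} {v} u∈T₁ v∈T₂ uv∈W =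
    let y , y∈W , cuv~y , σcuv~y = ⇝σ c uv∈W
    in W-resp (≈ᴹ-sym (~₁∧~₂⇒≈ (T₁.~-trans mod₁ σcuv~y) (T₂.~-trans mod₂ cuv~y))) y∈W
    where
    mod₁ : c *ₗ u +ᴹ σ c *ₗ v ~ σ c *ₗ (u +ᴹ v) [mod ∣ T₁ ∣ ]
    mod₁ = T₁.~-trans
      (T₁.+-cong-~ (T₁.~-trans (T₁.∈⇒~0 (T₁.T.*-closed {c} _ u∈T₁))
        (T₁.~-sym (T₁.∈⇒~0 (T₁.T.*-closed {σ c} _ u∈T₁)))) (T₁.≈⇒~ ≈ᴹ-refl))
      (T₁.≈⇒~ (≈ᴹ-sym (*ₗ-distribˡ (σ c) u v)))
    mod₂ : c *ₗ u +ᴹ σ c *ₗ v ~ c *ₗ (u +ᴹ v) [mod ∣ T₂ ∣ ]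
    mod₂ = T₂.~-trans
      (T₂.+-cong-~ (T₂.≈⇒~ ≈ᴹ-refl) (T₂.~-trans (T₂.∈⇒~0 (T₂.T.*-closed {σ c} _ v∈T₂))
        (T₂.~-sym (T₂.∈⇒~0 (T₂.T.*-closed {c} _ v∈T₂)))))
      (T₂.≈⇒~ (≈ᴹ-sym (*ₗ-distribˡ c u v)))

  f : Σ Carrierᴹ ∣ T₁ ∣ → Σ Carrierᴹ ∣ T₂ ∣
  f (u , _) = let v , v∈T₂ , _ = graph-∃ u in v , v∈T₂

  f-graph : ∀ x → W (proj₁ x +ᴹ proj₁ (f x))
  f-graph (u , _) = proj₂ (proj₂ (graph-∃ u))

  -- Reduces additivity, semilinearity and surjectivity of `f` to exhibiting vectors of `W` with
  -- prescribed components.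
  f-unique : ∀ x {v} → ∣ T₂ ∣ v → W (proj₁ x +ᴹ v) → proj₁ (f x) ≈ᴹ v
  f-unique x v∈T₂ = graph-unique ≈ᴹ-refl (proj₂ (f x)) v∈T₂ (f-graph x)

  f-semilinear : IsInvertibleSemilinear T₁ T₂ σ f
  f-semilinear = record
    { f-cong     = λ {x} {y} x≈y → graph-unique x≈y (proj₂ (f x)) (proj₂ (f y)) (f-graph x) (f-graph y)
    ; additive   = λ p q → let x = _ , p ; y = _ , q in
        f-unique (_ , T₁.T.+-closed p q) (T₂.T.+-closed (proj₂ (f x)) (proj₂ (f y)))
          (W-resp (+ᴹ-interchange _ _ _ _) (W-+ (f-graph x) (f-graph y)))
    ; semilinear = λ c p → let x = _ , p in
        f-unique (_ , T₁.T.*-closed {c} _ p) (T₂.T.*-closed {σ c} _ (proj₂ (f x)))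
          (graph-semilinear c p (proj₂ (f x)) (f-graph x))
    ; bijective  =
        (λ {x} {y} fx≈fy → graph-injective (proj₂ x) (proj₂ y) fx≈fy (f-graph x) (f-graph y)) ,
        λ (v , v∈T₂) →
          -- The preimage of `v` is the `T₁`-component of the representative of `v` in `W` modulo
          -- `T₁`.
          let w , w∈W , v~w = T₁.W-complement v
          in (w -ᴹ v , T₁.~-sym v~w) , λ {z} z≈ → f-unique z v∈T₂
               (W-resp (≈ᴹ-trans (≈ᴹ-sym (MG.//-rightDividesˡ v w)) (+ᴹ-congʳ (≈ᴹ-sym z≈))) w∈W)
    }

  -- The points of the linear set

  graph-point : ∀ x → proj₁ x +ᴹ proj₁ (f x) ≈ᴹ proj₁ x +ᴹ 1# *ₗ proj₁ (f x)
  graph-point x = +ᴹ-congˡ (≈ᴹ-sym (*ₗ-identityˡ _))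

  L⊆L[1,f] : L ⊆ L[_,_] F {U₁ = T₁} {U₂ = T₂} 1# f
  L⊆L[1,f] {P} P∈L =
    let w , w∈W , w≉0 , P≐⟨w⟩ = proj₁ L≐L_W {P} P∈L
        u , v , u∈T₁ , v∈T₂ , w≈ = IsDirectSum.decompose T₁⊕T₂ w
        x = u , u∈T₁
        uv∈W = W-resp w≈ w∈W
        w≈u+fu = ≈ᴹ-trans w≈ (≈ᴹ-trans (+ᴹ-congˡ (≈ᴹ-sym (f-unique x v∈T₂ uv∈W))) (graph-point x))
        ⊆ , ⊇ = ⟨⟩-cong w≈u+fu
        -- If `u` vanished, `w` would be a nonzero vector of `W` in `T₂`.
        u≉0 = λ u≈0 → w≉0 (T₂.W∩T w∈W (T₂.T.resp
          (≈ᴹ-sym (≈ᴹ-trans w≈ (≈ᴹ-trans (+ᴹ-congʳ u≈0) (+ᴹ-identityˡ v)))) v∈T₂))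
    in x , u≉0 , (λ y∈P → ⊆ (proj₁ P≐⟨w⟩ y∈P)) , (λ y∈ → proj₂ P≐⟨w⟩ (⊇ y∈))

  L[1,f]⊆L : L[_,_] F {U₁ = T₁} {U₂ = T₂} 1# f ⊆ L
  L[1,f]⊆L {P} (x@(u , u∈T₁) , u≉0 , P≐) =
    proj₂ L≐L_W {P} (u +ᴹ 1# *ₗ v , W-resp (graph-point x) (f-graph x) , w≉0 , P≐)
    where
    v = proj₁ (f x)
    w≉0 : NonZeroᴹ (u +ᴹ 1# *ₗ v)
    -- A zero sum would make `u` the negative of a vector of `T₂`, hence zero.
    w≉0 w≈0 = u≉0 (T₁∩T₂ u∈T₁ (T₂.T.resp
      (≈ᴹ-sym (MG.inverseˡ-unique u v (≈ᴹ-trans (graph-point x) w≈0))) (T₂.T.neg-closed (proj₂ (f x)))))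

  ofForm-Lρf : IsOfForm-Lρf F n L
  ofForm-Lρf = record
    { U₁        = T₁
    ; U₂        = T₂
    ; directSum = T₁⊕T₂
    ; σ         = σ
    ; σ-auto    = σ-automorphism
    ; Fix-σ     = Fix-σ≐F
    ; f         = f
    ; f-semilin = f-semilinear
    -- `W` is the graph of `f` itself, so the scalar is 1.
    ; ρ         = 1#
    ; ρ≉0       = 0≉1 ∘ sym
    ; L≐L[ρ,f]  = L⊆L[1,f] , L[1,f]⊆L
    }

open import Data.Nat.Base using (_*_)

theorem3p12 : {a : Level} (q n t : ℕ) → 2 ≤ n → 2 ≤ t →
    (K : CommutativeRing a a) → IsField K → HasSize (CommutativeRing.setoid K) (q ^ t) →
    (F : Subfield K) → HasSize (Subfield.asSetoid F) q →
    (V : Module K a a) → LinearAlgebra.HasDim K V U U (2 * n) →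
    (L : Pred (LinearAlgebra.Point K V) a) →
    LinearAlgebra.IsPseudoregulusType K V F q n t L →
    LinearAlgebra.IsOfForm-Lρf K V F n L
theorem3p12 q n t = PseudoregulusType.ofForm-Lρf
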